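{- Let $n\ge 8$, let $G_n\in HL_n$, and let $g$ be a positive integer with $g\le 2^{\lceil n/2\rceil}$. Then $c\lambda_{g+1}(G_n)=ng-e_g$, where $e_g=\max\{|E(G_n[X])| : X\subseteq V(G_n),\ |X|=g\}$.
   Context: HL-networks are defined recursively: $HL_0=\{K_1\}$ and $HL_n=\{G_{n-1}\oplus G^*_{n-1} : G_{n-1},G^*_{n-1}\in HL_{n-1}\}$, where $G_{n-1}\oplus G^*_{n-1}$ denotes any graph obtained from the disjoint union of $G_{n-1}$ and $G^*_{n-1}$ by adding a perfect matching between their vertex sets. Each $G_n\in HL_n$ is $n$-regular with $2^n$ vertices. For a graph $G$, a $k$-component edge cut is a set $F\subseteq E(G)$ such that $G-F$ has at least $k$ connected components; the $k$-component edge connectivity $c\lambda_k(G)$ is the minimum size of a $k$-component edge cut of $G$. -}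

module Defs where

open import Data.Nat using (ℕ; zero; suc; _+_; _≤_)
open import Data.Bool using (Bool; true; false; _∧_; not; if_then_else_)
open import Data.Fin using (Fin; splitAt; _<?_; _≟_)
open import Data.Fin.Permutation using (Permutation′; _⟨$⟩ʳ_)
open import Data.Sum using (inj₁; inj₂)
open import Data.List using (map; allFin)
open import Data.Nat.ListAction using (sum)
open import Data.Product using (Σ; _×_; ∃)
open import Relation.Nullary using (¬_; does)
open import Relation.Binary.PropositionalEquality using (_≡_; _≢_)

Adj : ℕ → Set
Adj m = Fin m → Fin m → Bool

size : ℕ → ℕ
size zero    = 1
size (suc n) = size n + size n

-- G ⊕ G* : disjoint union (left copy = first `size n` vertices, right copy the rest)
-- plus the perfect matching  a ↔ π(a).
⊕ : ∀ {k} → Adj k → Adj k → Permutation′ k → Adj (k + k)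
⊕ {k} A B π i j with splitAt k i | splitAt k j
... | inj₁ a | inj₁ a′ = A a a′
... | inj₂ b | inj₂ b′ = B b b′
... | inj₁ a | inj₂ b  = does ((π ⟨$⟩ʳ a) ≟ b)
... | inj₂ b | inj₁ a  = does ((π ⟨$⟩ʳ a) ≟ b)

relabel : ∀ {m} → Permutation′ m → Adj m → Adj m
relabel σ A i j = A (σ ⟨$⟩ʳ i) (σ ⟨$⟩ʳ j)

data HL : (n : ℕ) → Adj (size n) → Set where
  base : HL zero (λ _ _ → false)
  step : ∀ {n A B} → HL n A → HL n B → (π : Permutation′ (size n)) →
         HL (suc n) (⊕ A B π)
  iso  : ∀ {n A} → HL n A → (σ : Permutation′ (size n)) → HL n (relabel σ A)

count : ∀ {m} → (Fin m → Bool) → ℕ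
count P = sum (map (λ i → if P i then 1 else 0) (allFin _))

countPairs : ∀ {m} → Adj m → ℕ
countPairs {m} R =
  sum (map (λ i → sum (map (λ j → if does (i <? j) ∧ R i j then 1 else 0) (allFin m))) (allFin m))

VSet : ℕ → Set
VSet m = Fin m → Bool

inducedEdges : ∀ {m} → Adj m → VSet m → ℕ
inducedEdges A X = countPairs (λ i j → X i ∧ X j ∧ A i j)

IsMaxInduced : ∀ {m} → Adj m → ℕ → ℕ → Set
IsMaxInduced {m} A g e =
  (Σ (VSet m) λ X → count X ≡ g × inducedEdges A X ≡ e) ×
  ((X : VSet m) → count X ≡ g → inducedEdges A X ≤ e)

IsEdgeSubset : ∀ {m} → Adj m → Adj m → Set
IsEdgeSubset A F = (∀ i j → F i j ≡ F j i) × (∀ i j → F i j ≡ true → A i j ≡ true)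

deleteEdges : ∀ {m} → Adj m → Adj m → Adj m
deleteEdges A F i j = A i j ∧ not (F i j)

data Reach {m} (A : Adj m) : Fin m → Fin m → Set where
  here : ∀ {i} → Reach A i i
  there : ∀ {i j k} → A i j ≡ true → Reach A j k → Reach A i k

AtLeastComponents : ∀ {m} → ℕ → Adj m → Set
AtLeastComponents {m} k A =
  Σ (Fin k → Fin m) λ r → ∀ a b → a ≢ b → ¬ Reach A (r a) (r b)

IsKCut : ∀ {m} → ℕ → Adj m → Adj m → Set
IsKCut k A F = IsEdgeSubset A F × AtLeastComponents k (deleteEdges A F)

IsCλ : ∀ {m} → ℕ → Adj m → ℕ → Set
IsCλ {m} k A c =
  (Σ (Adj m) λ F → IsKCut k A F × countPairs F ≡ c) ×
  ((F : Adj m) → IsKCut k A F → c ≤ countPairs F)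

{-# OPTIONS --safe #-}

-- Let e(a) be the number of edges spanned by the first a vertices of the hypercube.
-- Splitting along the matching and using e(a) + e(b) + min(a, b) ≤ e(a + b), every
-- a-set of an HL-network spans at most e(a) edges, and some a-set attains this, so e_g = e(g).
-- Cutting all edges incident to an extremal g-set isolates its vertices and costs
-- ng − e(g). Conversely, group the components left by a cut into g + 1 nonempty parts.
-- Since e(a) + e(b) ≤ e(a + b − 1), the parts contain at most e(2ⁿ − g) edges in total,
-- as if all but one were singletons. Complementing an extremal (2ⁿ − g)-set bounds
-- e(2ⁿ − g) by |E| − ng + e(g), which leaves at least ng − e(g) edges in the cut.

module Submission where

open import Defs
open import Data.Nat.Properties hiding (_≟_; <-cmp; _<?_; suc-injective)
open import Algebra.Properties.CommutativeMonoid.Sum +-0-commutativeMonoid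
  using (sum; sum-cong-≗; sum-permute; sum-replicate-zero; ∑-comm; ∑-distrib-+)
open import Algebra.Properties.Semiring.Sum +-*-semiring using (*-distribˡ-sum)
open import Data.Bool using (Bool; true; false; _∧_; _∨_; not; if_then_else_)
open import Data.Bool.Properties using (∧-assoc; ∧-comm; ∧-identityʳ; ∧-zeroʳ; ∨-comm; ∨-zeroʳ; not-involutive)
open import Data.Fin using (Fin; zero; suc; splitAt; join; _↑ˡ_; _↑ʳ_; _<?_; _≟_)
open import Data.Fin.Permutation using (Permutation′; _⟨$⟩ʳ_; _⟨$⟩ˡ_; flip; inverseˡ)
open import Data.Fin.Properties using (splitAt-↑ˡ; splitAt-↑ʳ; join-splitAt; <-cmp; suc-injective; any?; sequence)
import Data.List as List using (map; allFin; tabulate)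
open import Data.List.Properties using (map-tabulate)
open import Data.Nat using (ℕ; zero; suc; pred; _+_; _*_; _∸_; _^_; _≤_; _<_; z≤n; s≤s; ⌊_/2⌋; ⌈_/2⌉)
import Data.Nat.ListAction as List using (sum)
open import Data.Nat.Tactic.RingSolver using (solve-∀)
open import Data.Product using (Σ; _×_; _,_; proj₁; proj₂)
open import Data.Sum using (_⊎_; inj₁; inj₂; [_,_]′)
open import Effect.Monad using (RawMonad)
open import Function using (_∘_; id)
open import Relation.Binary.Definitions using (tri<; tri≈; tri>)
open import Relation.Binary.PropositionalEquality
open import Relation.Nullary using (¬_; Dec; yes; no; does; contradiction)
open import Relation.Nullary.Decidable using (dec-true; dec-false; decidable-stable; ¬¬-excluded-middle)
open import Relation.Nullary.Negation using (¬¬-map; ¬¬-Monad)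

-- Parity and halving.

data Parity : ℕ → Set where
  even : ∀ k → Parity (k + k)
  odd  : ∀ k → Parity (suc (k + k))

parity : ∀ a → Parity a
parity zero = even zero
parity (suc a) with parity a
... | even k = odd k
... | odd k  = subst Parity (cong suc (+-suc k k)) (even (suc k))

-- Undoes the doubling that occurs both in `size` and in edge counts over ordered pairs.
double-cancel-≤ : ∀ {a b} → a + a ≤ b + b → a ≤ b
double-cancel-≤ {a} {b} p =
  subst₂ _≤_ (sym (n≡⌊n+n/2⌋ a)) (sym (n≡⌊n+n/2⌋ b)) (⌊n/2⌋-mono p)

⌊/2⌋≤ : ∀ {a b} → a ≤ suc (b + b) → ⌊ a /2⌋ ≤ b
⌊/2⌋≤ {a} {b} p = subst (⌊ a /2⌋ ≤_) (sym (n≡⌈n+n/2⌉ b)) (⌊n/2⌋-mono p)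

⌈/2⌉≤ : ∀ {a b} → a ≤ b + b → ⌈ a /2⌉ ≤ b
⌈/2⌉≤ p = ⌊/2⌋≤ (s≤s p)

-- The extremal function of the hypercube and its inequalities.

-- For a ≤ 2ⁿ this is the number of edges spanned by the first a vertices of the n-cube.
ex : ℕ → ℕ → ℕ
ex zero    a = 0
ex (suc n) a = ex n ⌊ a /2⌋ + ex n ⌈ a /2⌉ + ⌊ a /2⌋

ex-even : ∀ n k → ex (suc n) (k + k) ≡ ex n k + ex n k + k
ex-even n k rewrite sym (n≡⌊n+n/2⌋ k) | sym (n≡⌈n+n/2⌉ k) = refl

ex-odd : ∀ n k → ex (suc n) (suc (k + k)) ≡ ex n k + ex n (suc k) + k
ex-odd n k rewrite sym (n≡⌊n+n/2⌋ k) | sym (n≡⌈n+n/2⌉ k) = refl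

-- Any `m` below both sizes stands in for min(a, b), so that an induction can split `m` into halves.
-- The right side sits one level higher because `a + b` may exceed `size n`.
Joins : ℕ → Set
Joins n = ∀ a b m → a ≤ size n → b ≤ size n → m ≤ a → m ≤ b →
          ex n a + ex n b + m ≤ ex (suc n) (a + b)

half-< : ∀ {k s} → suc (k + k) ≤ s + s → suc k ≤ s
half-< {k} {s} p = subst (λ x → suc x ≤ s) (sym (n≡⌊n+n/2⌋ k)) (⌈/2⌉≤ p)

-- Both arguments consist of two equal halves. Pairing `k` with `l` twice uses the hypothesis once
-- for each half of `m`; the remaining `k + l` is half of the total.
joins-even-even : ∀ n → Joins n → ∀ k l m → k ≤ size n → l ≤ size n → m ≤ k + k → m ≤ l + l →
  ex (suc n) (k + k) + ex (suc n) (l + l) + m ≤ ex (suc (suc n)) ((k + k) + (l + l))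
joins-even-even n ih k l m k≤ l≤ m≤a m≤b = begin
  ex (suc n) (k + k) + ex (suc n) (l + l) + m
    ≡⟨ cong₂ _+_ (cong₂ _+_ (ex-even n k) (ex-even n l)) (sym (⌊n/2⌋+⌈n/2⌉≡n m)) ⟩
  (ex n k + ex n k + k) + (ex n l + ex n l + l) + (⌊ m /2⌋ + ⌈ m /2⌉)
    ≡⟨ lemma (ex n k) (ex n l) k l ⌊ m /2⌋ ⌈ m /2⌉ ⟩
  (ex n k + ex n l + ⌊ m /2⌋) + (ex n k + ex n l + ⌈ m /2⌉) + (k + l)
    ≤⟨ +-monoˡ-≤ (k + l) (+-mono-≤
         (ih k l _ k≤ l≤ (⌊/2⌋≤ (m≤n⇒m≤1+n m≤a)) (⌊/2⌋≤ (m≤n⇒m≤1+n m≤b)))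
         (ih k l _ k≤ l≤ (⌈/2⌉≤ m≤a) (⌈/2⌉≤ m≤b))) ⟩
  ex (suc n) (k + l) + ex (suc n) (k + l) + (k + l)
    ≡⟨ ex-even (suc n) (k + l) ⟨
  ex (suc (suc n)) ((k + l) + (k + l))
    ≡⟨ cong (ex (suc (suc n))) (arg k l) ⟩
  ex (suc (suc n)) ((k + k) + (l + l)) ∎
  where
  open ≤-Reasoning
  lemma : ∀ p q k l m m′ → (p + p + k) + (q + q + l) + (m + m′) ≡ (p + q + m) + (p + q + m′) + (k + l)
  lemma = solve-∀
  arg : ∀ k l → (k + l) + (k + l) ≡ (k + k) + (l + l)
  arg = solve-∀

-- The halves `k` and `suc k` of the odd argument are each paired with `l`. The smaller half of `m`
-- goes with `k`, the larger one with `suc k`.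
joins-odd-even : ∀ n → Joins n → ∀ k l m → k < size n → l ≤ size n → m ≤ suc (k + k) → m ≤ l + l →
  ex (suc n) (suc (k + k)) + ex (suc n) (l + l) + m ≤ ex (suc (suc n)) (suc (k + k) + (l + l))
joins-odd-even n ih k l m k< l≤ m≤a m≤b = begin
  ex (suc n) (suc (k + k)) + ex (suc n) (l + l) + m
    ≡⟨ cong₂ _+_ (cong₂ _+_ (ex-odd n k) (ex-even n l)) (sym (⌊n/2⌋+⌈n/2⌉≡n m)) ⟩
  (ex n k + ex n (suc k) + k) + (ex n l + ex n l + l) + (⌊ m /2⌋ + ⌈ m /2⌉)
    ≡⟨ lemma (ex n k) (ex n (suc k)) (ex n l) k l ⌊ m /2⌋ ⌈ m /2⌉ ⟩
  (ex n k + ex n l + ⌊ m /2⌋) + (ex n (suc k) + ex n l + ⌈ m /2⌉) + (k + l)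
    ≤⟨ +-monoˡ-≤ (k + l) (+-mono-≤
         (ih k l _ (<⇒≤ k<) l≤ (⌊/2⌋≤ m≤a) (⌊/2⌋≤ (m≤n⇒m≤1+n m≤b)))
         (ih (suc k) l _ k< l≤ (⌈/2⌉≤ (≤-trans m≤a (s≤s (+-monoʳ-≤ k (n≤1+n k))))) (⌈/2⌉≤ m≤b))) ⟩
  ex (suc n) (k + l) + ex (suc n) (suc (k + l)) + (k + l)
    ≡⟨ ex-odd (suc n) (k + l) ⟨
  ex (suc (suc n)) (suc ((k + l) + (k + l)))
    ≡⟨ cong (ex (suc (suc n))) (arg k l) ⟩
  ex (suc (suc n)) (suc (k + k) + (l + l)) ∎
  where
  open ≤-Reasoning
  lemma : ∀ p p′ q k l m m′ → (p + p′ + k) + (q + q + l) + (m + m′) ≡ (p + q + m) + (p′ + q + m′) + (k + l)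
  lemma = solve-∀
  arg : ∀ k l → suc ((k + l) + (k + l)) ≡ suc (k + k) + (l + l)
  arg = solve-∀

-- The halves are paired crosswise, `suc k` with `l` and `k` with `suc l`, so both sums equal
-- `suc (k + l)`. Half of the total exceeds `k + l` by one, which pays for one unit of `m`; only
-- `pred m` is split.
joins-odd-odd : ∀ n → Joins n → ∀ k l m → k < size n → l < size n → m ≤ suc (k + k) → m ≤ suc (l + l) →
  ex (suc n) (suc (k + k)) + ex (suc n) (suc (l + l)) + m ≤ ex (suc (suc n)) (suc (k + k) + suc (l + l))
joins-odd-odd n ih k l m k< l< m≤a m≤b = begin
  ex (suc n) (suc (k + k)) + ex (suc n) (suc (l + l)) + m
    ≤⟨ +-mono-≤ (≤-reflexive (cong₂ _+_ (ex-odd n k) (ex-odd n l))) (suc-pred-≤ m) ⟩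
  (ex n k + ex n (suc k) + k) + (ex n l + ex n (suc l) + l) + suc p
    ≡⟨ cong (λ x → (ex n k + ex n (suc k) + k) + (ex n l + ex n (suc l) + l) + suc x) (sym (⌊n/2⌋+⌈n/2⌉≡n p)) ⟩
  (ex n k + ex n (suc k) + k) + (ex n l + ex n (suc l) + l) + suc (⌊ p /2⌋ + ⌈ p /2⌉)
    ≡⟨ lemma (ex n k) (ex n (suc k)) (ex n l) (ex n (suc l)) k l ⌊ p /2⌋ ⌈ p /2⌉ ⟩
  (ex n (suc k) + ex n l + ⌊ p /2⌋) + (ex n k + ex n (suc l) + ⌈ p /2⌉) + suc (k + l)
    ≤⟨ +-monoˡ-≤ (suc (k + l)) (+-mono-≤
         (ih (suc k) l _ k< (<⇒≤ l<) (m≤n⇒m≤1+n (⌊/2⌋≤ (m≤n⇒m≤1+n p≤a))) (⌊/2⌋≤ (m≤n⇒m≤1+n p≤b)))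
         (ih k (suc l) _ (<⇒≤ k<) l< (⌈/2⌉≤ p≤a) (m≤n⇒m≤1+n (⌈/2⌉≤ p≤b)))) ⟩
  ex (suc n) (suc k + l) + ex (suc n) (k + suc l) + suc (k + l)
    ≡⟨ cong (λ x → ex (suc n) (suc k + l) + ex (suc n) x + suc (k + l)) (+-suc k l) ⟩
  ex (suc n) (suc k + l) + ex (suc n) (suc k + l) + suc (k + l)
    ≡⟨ ex-even (suc n) (suc (k + l)) ⟨
  ex (suc (suc n)) (suc (k + l) + suc (k + l))
    ≡⟨ cong (ex (suc (suc n))) (arg k l) ⟩
  ex (suc (suc n)) (suc (k + k) + suc (l + l)) ∎
  where
  open ≤-Reasoning
  p = pred m
  suc-pred-≤ : ∀ m → m ≤ suc (pred m)
  suc-pred-≤ zero    = z≤n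
  suc-pred-≤ (suc m) = ≤-refl
  p≤a = pred-mono-≤ m≤a
  p≤b = pred-mono-≤ m≤b
  lemma : ∀ p p′ q q′ k l m m′ →
    (p + p′ + k) + (q + q′ + l) + suc (m + m′) ≡ (p′ + q + m) + (p + q′ + m′) + suc (k + l)
  lemma = solve-∀
  arg : ∀ k l → suc (k + l) + suc (k + l) ≡ suc (k + k) + suc (l + l)
  arg = solve-∀

ex-join : ∀ n → Joins n
ex-join zero zero b m _ _ m≤a _ = ≤-trans m≤a z≤n
ex-join zero (suc zero) zero m _ _ _ m≤b = m≤b
ex-join zero (suc zero) (suc zero) m _ _ m≤a _ = m≤a
ex-join zero (suc (suc _)) _ _ (s≤s ()) _ _ _
ex-join zero (suc zero) (suc (suc _)) _ _ (s≤s ()) _ _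
ex-join (suc n) a b m a≤ b≤ m≤a m≤b with parity a | parity b
... | even k | even l =
  joins-even-even n (ex-join n) k l m (double-cancel-≤ a≤) (double-cancel-≤ b≤) m≤a m≤b
... | odd k | even l =
  joins-odd-even n (ex-join n) k l m (half-< a≤) (double-cancel-≤ b≤) m≤a m≤b
... | even k | odd l =
  subst₂ (λ x y → x + m ≤ ex (suc (suc n)) y)
    (+-comm (ex (suc n) (suc (l + l))) _) (+-comm (suc (l + l)) (k + k))
    (joins-odd-even n (ex-join n) l k m (half-< b≤) (double-cancel-≤ a≤) m≤b m≤a)
... | odd k | odd l =
  joins-odd-odd n (ex-join n) k l m (half-< a≤) (half-< b≤) m≤a m≤b

-- The first `a` vertices already lie in a cube of dimension `n`, so raising the dimension adds no
-- edges.
ex-level : ∀ n a → a ≤ size n → ex (suc n) a ≤ ex n a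
ex-level zero zero _ = z≤n
ex-level zero (suc zero) _ = z≤n
ex-level zero (suc (suc _)) (s≤s ())
ex-level (suc n) a a≤ =
  +-monoˡ-≤ ⌊ a /2⌋ (+-mono-≤
    (ex-level n ⌊ a /2⌋ (⌊/2⌋≤ (m≤n⇒m≤1+n a≤))) (ex-level n ⌈ a /2⌉ (⌈/2⌉≤ a≤)))

-- `ex` recurses on the lowest binary digit; this is the split on the highest one: a full `n`-cube,
-- the first `r` vertices of the opposite `n`-cube, and `r` edges between them.
ex-top : ∀ n r → r ≤ size n → ex (suc n) (size n + r) ≤ ex n (size n) + ex n r + r
ex-top zero zero _ = z≤n
ex-top zero (suc zero) _ = ≤-refl
ex-top zero (suc (suc _)) (s≤s ())
ex-top (suc n) r r≤ with parity r
... | even s = begin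
  ex (suc (suc n)) ((M + M) + (s + s))      ≡⟨ cong (ex (suc (suc n))) (arg M s) ⟩
  ex (suc (suc n)) ((M + s) + (M + s))      ≡⟨ ex-even (suc n) (M + s) ⟩
  ex (suc n) (M + s) + ex (suc n) (M + s) + (M + s)
    ≤⟨ +-monoˡ-≤ (M + s) (+-mono-≤ (ex-top n s s≤) (ex-top n s s≤)) ⟩
  (ex n M + ex n s + s) + (ex n M + ex n s + s) + (M + s)
    ≡⟨ lemma (ex n M) (ex n s) s M ⟩
  (ex n M + ex n M + M) + (ex n s + ex n s + s) + (s + s)
    ≡⟨ cong₂ (λ x y → x + y + (s + s)) (ex-even n M) (ex-even n s) ⟨
  ex (suc n) (M + M) + ex (suc n) (s + s) + (s + s) ∎
  where
  open ≤-Reasoning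
  M = size n
  s≤ = double-cancel-≤ r≤
  arg : ∀ M s → (M + M) + (s + s) ≡ (M + s) + (M + s)
  arg = solve-∀
  lemma : ∀ p q s M → (p + q + s) + (p + q + s) + (M + s) ≡ (p + p + M) + (q + q + s) + (s + s)
  lemma = solve-∀
... | odd s = begin
  ex (suc (suc n)) ((M + M) + suc (s + s))      ≡⟨ cong (ex (suc (suc n))) (arg M s) ⟩
  ex (suc (suc n)) (suc ((M + s) + (M + s)))    ≡⟨ ex-odd (suc n) (M + s) ⟩
  ex (suc n) (M + s) + ex (suc n) (suc (M + s)) + (M + s)
    ≡⟨ cong (λ x → ex (suc n) (M + s) + ex (suc n) x + (M + s)) (+-suc M s) ⟨
  ex (suc n) (M + s) + ex (suc n) (M + suc s) + (M + s)
    ≤⟨ +-monoˡ-≤ (M + s) (+-mono-≤ (ex-top n s (<⇒≤ s<)) (ex-top n (suc s) s<)) ⟩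
  (ex n M + ex n s + s) + (ex n M + ex n (suc s) + suc s) + (M + s)
    ≡⟨ lemma (ex n M) (ex n s) (ex n (suc s)) s M ⟩
  (ex n M + ex n M + M) + (ex n s + ex n (suc s) + s) + suc (s + s)
    ≡⟨ cong₂ (λ x y → x + y + suc (s + s)) (ex-even n M) (ex-odd n s) ⟨
  ex (suc n) (M + M) + ex (suc n) (suc (s + s)) + suc (s + s) ∎
  where
  open ≤-Reasoning
  M = size n
  s< = half-< r≤
  arg : ∀ M s → (M + M) + suc (s + s) ≡ suc ((M + s) + (M + s))
  arg = solve-∀
  lemma : ∀ p q q′ s M →
    (p + q + s) + (p + q′ + suc s) + (M + s) ≡ (p + p + M) + (q + q′ + s) + suc (s + s)
  lemma = solve-∀

-- In the cube an added vertex has at most `a` earlier neighbours; the recursion gives the same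
-- bound for every `a`.
ex-suc : ∀ n a → ex n (suc a) ≤ ex n a + a
ex-suc zero a = z≤n
ex-suc (suc n) a with parity a
... | even k = begin
  ex (suc n) (suc (k + k))            ≡⟨ ex-odd n k ⟩
  ex n k + ex n (suc k) + k           ≤⟨ +-monoˡ-≤ k (+-monoʳ-≤ (ex n k) (ex-suc n k)) ⟩
  ex n k + (ex n k + k) + k           ≡⟨ lemma (ex n k) k ⟩
  ex n k + ex n k + k + k             ≤⟨ +-monoʳ-≤ (ex n k + ex n k + k) (m≤m+n k k) ⟩
  ex n k + ex n k + k + (k + k)       ≡⟨ cong (_+ (k + k)) (ex-even n k) ⟨
  ex (suc n) (k + k) + (k + k)        ∎
  where
  open ≤-Reasoning
  lemma : ∀ p k → p + (p + k) + k ≡ p + p + k + k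
  lemma = solve-∀
... | odd k = begin
  ex (suc n) (suc (suc (k + k)))      ≡⟨ cong (ex (suc n)) (cong suc (+-suc k k)) ⟨
  ex (suc n) (suc k + suc k)          ≡⟨ ex-even n (suc k) ⟩
  ex n (suc k) + ex n (suc k) + suc k
    ≤⟨ +-monoˡ-≤ (suc k) (+-monoˡ-≤ (ex n (suc k)) (ex-suc n k)) ⟩
  (ex n k + k) + ex n (suc k) + suc k ≡⟨ lemma (ex n k) (ex n (suc k)) k ⟩
  ex n k + ex n (suc k) + k + suc k   ≤⟨ +-monoʳ-≤ (ex n k + ex n (suc k) + k) (s≤s (m≤m+n k k)) ⟩
  ex n k + ex n (suc k) + k + suc (k + k) ≡⟨ cong (_+ suc (k + k)) (ex-odd n k) ⟨
  ex (suc n) (suc (k + k)) + suc (k + k)  ∎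
  where
  open ≤-Reasoning
  lemma : ∀ p q k → (p + k) + q + suc k ≡ p + q + k + suc k
  lemma = solve-∀

-- Taking one vertex from the smaller part loses at most `u` edges by `ex-suc`. Joining the other
-- `u` vertices to the larger part gains `u` by `ex-join`, and `ex-level` returns to dimension `n`.
ex-shift-ordered : ∀ n t u → u ≤ t → suc (t + u) ≤ size n →
                   ex n (suc t) + ex n (suc u) ≤ ex n (suc (t + u))
ex-shift-ordered n t u u≤t t+u< = begin
  ex n (suc t) + ex n (suc u)   ≤⟨ +-monoʳ-≤ (ex n (suc t)) (ex-suc n u) ⟩
  ex n (suc t) + (ex n u + u)   ≡⟨ +-assoc (ex n (suc t)) (ex n u) u ⟨
  ex n (suc t) + ex n u + u
    ≤⟨ ex-join n (suc t) u u (≤-trans (s≤s (m≤m+n t u)) t+u<)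
         (≤-trans (m≤n+m u (suc t)) t+u<) (m≤n⇒m≤1+n u≤t) ≤-refl ⟩
  ex (suc n) (suc (t + u))      ≤⟨ ex-level n (suc (t + u)) t+u< ⟩
  ex n (suc (t + u))            ∎
  where open ≤-Reasoning

-- Moving all but one vertex of a part into another part does not decrease the bound on inner edges.
ex-shift : ∀ n t u → suc (t + u) ≤ size n → ex n (suc t) + ex n (suc u) ≤ ex n (suc (t + u))
ex-shift n t u t+u< with ≤-total u t
... | inj₁ u≤t = ex-shift-ordered n t u u≤t t+u<
... | inj₂ t≤u = subst₂ (λ x y → x ≤ ex n (suc y)) (+-comm (ex n (suc u)) _) (+-comm u t)
  (ex-shift-ordered n u t t≤u (subst (λ x → suc x ≤ size n) (+-comm t u) t+u<))

-- Counting vertices and ordered pairs.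

⟦_⟧ : Bool → ℕ
⟦ b ⟧ = if b then 1 else 0

≟-comm : ∀ {m} (a b : Fin m) → does (a ≟ b) ≡ does (b ≟ a)
≟-comm zero    zero    = refl
≟-comm zero    (suc b) = refl
≟-comm (suc a) zero    = refl
≟-comm (suc a) (suc b) = ≟-comm a b

∧-≤ˡ : ∀ x y → ⟦ x ∧ y ⟧ ≤ ⟦ x ⟧
∧-≤ˡ true  true  = ≤-refl
∧-≤ˡ true  false = z≤n
∧-≤ˡ false y     = z≤n

∧-≤ʳ : ∀ x y → ⟦ x ∧ y ⟧ ≤ ⟦ y ⟧
∧-≤ʳ true  y = ≤-refl
∧-≤ʳ false y = z≤n

# : ∀ {m} → VSet m → ℕ
# P = sum (λ i → ⟦ P i ⟧)

-- Ordered pairs are counted, so an undirected edge counts twice. Unlike a sum over `i < j`, this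
-- form behaves well under relabelling and under splitting the vertex set.
‖_‖ : ∀ {m} → Adj m → ℕ
‖ R ‖ = sum (λ i → # (R i))

induced : ∀ {m} → Adj m → VSet m → Adj m
induced A X i j = X i ∧ X j ∧ A i j

Symmetricᵇ : ∀ {m} → Adj m → Set
Symmetricᵇ R = ∀ i j → R i j ≡ R j i

Irreflexiveᵇ : ∀ {m} → Adj m → Set
Irreflexiveᵇ R = ∀ i → R i i ≡ false

sum-allFin : ∀ {m} (f : Fin m → ℕ) → List.sum (List.map f (List.allFin m)) ≡ sum f
sum-allFin f = trans (cong List.sum (map-tabulate id f)) (sum-tabulate f)
  where
  sum-tabulate : ∀ {m} (f : Fin m → ℕ) → List.sum (List.tabulate f) ≡ sum f
  sum-tabulate {zero}  f = refl
  sum-tabulate {suc m} f = cong (f zero +_) (sum-tabulate (f ∘ suc))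

count≡# : ∀ {m} (P : VSet m) → count P ≡ # P
count≡# P = sum-allFin (λ i → ⟦ P i ⟧)

sum-mono : ∀ {m} {f g : Fin m → ℕ} → (∀ i → f i ≤ g i) → sum f ≤ sum g
sum-mono {zero}  f≤g = z≤n
sum-mono {suc m} f≤g = +-mono-≤ (f≤g zero) (sum-mono (f≤g ∘ suc))

sum-const : ∀ m c → sum {m} (λ _ → c) ≡ m * c
sum-const zero    c = refl
sum-const (suc m) c = cong (c +_) (sum-const m c)

sum-++ : ∀ k {l} (f : Fin (k + l) → ℕ) →
         sum f ≡ sum (λ i → f (i ↑ˡ l)) + sum (λ j → f (k ↑ʳ j))
sum-++ zero    f = refl
sum-++ (suc k) f = trans (cong (f zero +_) (sum-++ k (f ∘ suc))) (sym (+-assoc (f zero) _ _))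

#-cong : ∀ {m} {P Q : VSet m} → P ≗ Q → # P ≡ # Q
#-cong P≗Q = sum-cong-≗ (λ i → cong ⟦_⟧ (P≗Q i))

‖‖-cong : ∀ {m} {R S : Adj m} → (∀ i j → R i j ≡ S i j) → ‖ R ‖ ≡ ‖ S ‖
‖‖-cong R≗S = sum-cong-≗ (λ i → #-cong (R≗S i))

sum₂-distrib-+ : ∀ {k l} (f g : Fin k → Fin l → ℕ) →
  sum (λ i → sum (λ j → f i j + g i j)) ≡ sum (λ i → sum (f i)) + sum (λ i → sum (g i))
sum₂-distrib-+ f g =
  trans (sum-cong-≗ (λ i → ∑-distrib-+ (f i) (g i))) (∑-distrib-+ (λ i → sum (f i)) (λ i → sum (g i)))

#-permute : ∀ {m} (P : VSet m) (σ : Permutation′ m) → # (λ i → P (σ ⟨$⟩ʳ i)) ≡ # P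
#-permute P σ = sym (sum-permute (λ i → ⟦ P i ⟧) σ)

#-pick : ∀ {m} (c : Fin m) (P : VSet m) → # (λ b → P b ∧ does (c ≟ b)) ≡ ⟦ P c ⟧
#-pick {suc m} zero P =
  trans (cong₂ _+_ (cong ⟦_⟧ (∧-identityʳ (P zero)))
                   (trans (#-cong (λ b → ∧-zeroʳ (P (suc b)))) (sum-replicate-zero m)))
        (+-identityʳ _)
#-pick {suc m} (suc c) P =
  cong₂ _+_ (cong ⟦_⟧ (∧-zeroʳ (P zero))) (#-pick c (P ∘ suc))

#-not : ∀ {m} (X : VSet m) → # X + # (not ∘ X) ≡ m
#-not {m} X = begin
  # X + # (not ∘ X)                    ≡⟨ ∑-distrib-+ (λ i → ⟦ X i ⟧) (λ i → ⟦ not (X i) ⟧) ⟨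
  sum (λ i → ⟦ X i ⟧ + ⟦ not (X i) ⟧)  ≡⟨ sum-cong-≗ (λ i → one (X i)) ⟩
  sum {m} (λ i → 1)                    ≡⟨ sum-const m 1 ⟩
  m * 1                                ≡⟨ *-identityʳ m ⟩
  m ∎
  where
  open ≡-Reasoning
  one : ∀ b → ⟦ b ⟧ + ⟦ not b ⟧ ≡ 1
  one true  = refl
  one false = refl

-- The sum over `i < j` and its transpose cover the pairs off the diagonal by symmetry, and
-- irreflexivity empties the diagonal.
double-countPairs : ∀ {m} (R : Adj m) → Symmetricᵇ R → Irreflexiveᵇ R →
                    countPairs R + countPairs R ≡ ‖ R ‖
double-countPairs {m} R R-sym R-irrefl = begin
  countPairs R + countPairs R
    ≡⟨ cong₂ _+_ unfold (trans unfold (∑-comm f)) ⟩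
  sum (λ i → sum (f i)) + sum (λ i → sum (λ j → f j i))
    ≡⟨ sum₂-distrib-+ f (λ i j → f j i) ⟨
  sum (λ i → sum (λ j → f i j + f j i))
    ≡⟨ sum-cong-≗ (λ i → sum-cong-≗ (pointwise i)) ⟩
  ‖ R ‖ ∎
  where
  open ≡-Reasoning
  f : Fin m → Fin m → ℕ
  f i j = ⟦ does (i <? j) ∧ R i j ⟧
  unfold : countPairs R ≡ sum (λ i → sum (f i))
  unfold = trans (sum-allFin (λ i → List.sum (List.map (f i) (List.allFin m)))) (sum-cong-≗ (λ i → sum-allFin (f i)))
  pointwise : ∀ i j → f i j + f j i ≡ ⟦ R i j ⟧
  pointwise i j with <-cmp i j
  ... | tri< i<j _ j≮i rewrite dec-true (i <? j) i<j | dec-false (j <? i) j≮i = +-identityʳ _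
  ... | tri> i≮j _ j<i rewrite dec-false (i <? j) i≮j | dec-true (j <? i) j<i = cong ⟦_⟧ (R-sym j i)
  ... | tri≈ i≮i refl _ rewrite dec-false (i <? i) i≮i = sym (cong ⟦_⟧ (R-irrefl i))

induced-symmetric : ∀ {m} {A : Adj m} (X : VSet m) → Symmetricᵇ A → Symmetricᵇ (induced A X)
induced-symmetric {A = A} X A-sym i j rewrite A-sym i j with X i | X j
... | true  | true  = refl
... | true  | false = refl
... | false | true  = refl
... | false | false = refl

induced-irreflexive : ∀ {m} {A : Adj m} (X : VSet m) → Irreflexiveᵇ A → Irreflexiveᵇ (induced A X)
induced-irreflexive X A-irrefl i rewrite A-irrefl i | ∧-zeroʳ (X i) = ∧-zeroʳ (X i)

relabel-‖‖ : ∀ {m} (R : Adj m) (σ : Permutation′ m) → ‖ relabel σ R ‖ ≡ ‖ R ‖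
relabel-‖‖ R σ =
  trans (sum-cong-≗ (λ i → #-permute (R (σ ⟨$⟩ʳ i)) σ)) (sym (sum-permute (λ i → # (R i)) σ))

-- Degrees and induced edges across a perfect matching.

module _ {k : ℕ} (A B : Adj k) (π : Permutation′ k) where

  ⊕-ll : ∀ a a′ → ⊕ A B π (a ↑ˡ k) (a′ ↑ˡ k) ≡ A a a′
  ⊕-ll a a′ rewrite splitAt-↑ˡ k a k | splitAt-↑ˡ k a′ k = refl

  ⊕-rr : ∀ b b′ → ⊕ A B π (k ↑ʳ b) (k ↑ʳ b′) ≡ B b b′
  ⊕-rr b b′ rewrite splitAt-↑ʳ k k b | splitAt-↑ʳ k k b′ = refl

  ⊕-lr : ∀ a b → ⊕ A B π (a ↑ˡ k) (k ↑ʳ b) ≡ does ((π ⟨$⟩ʳ a) ≟ b)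
  ⊕-lr a b rewrite splitAt-↑ˡ k a k | splitAt-↑ʳ k k b = refl

  ⊕-rl : ∀ b a → ⊕ A B π (k ↑ʳ b) (a ↑ˡ k) ≡ does ((π ⟨$⟩ʳ a) ≟ b)
  ⊕-rl b a rewrite splitAt-↑ˡ k a k | splitAt-↑ʳ k k b = refl

  ⊕-symmetric : Symmetricᵇ A → Symmetricᵇ B → Symmetricᵇ (⊕ A B π)
  ⊕-symmetric A-sym B-sym i j with splitAt k i | splitAt k j
  ... | inj₁ a | inj₁ a′ = A-sym a a′
  ... | inj₂ b | inj₂ b′ = B-sym b b′
  ... | inj₁ a | inj₂ b  = refl
  ... | inj₂ b | inj₁ a  = refl

  ⊕-irreflexive : Irreflexiveᵇ A → Irreflexiveᵇ B → Irreflexiveᵇ (⊕ A B π)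
  ⊕-irreflexive A-irrefl B-irrefl i with splitAt k i
  ... | inj₁ a = A-irrefl a
  ... | inj₂ b = B-irrefl b

  -- The matching adds exactly one neighbour: `π a` for a left vertex, and for a right vertex its
  -- preimage, counted by reindexing along `π`.
  ⊕-regular : ∀ {d} → (∀ i → # (A i) ≡ d) → (∀ i → # (B i) ≡ d) → ∀ i → # (⊕ A B π i) ≡ suc d
  ⊕-regular {d} A-reg B-reg i = subst (λ i → # (⊕ A B π i) ≡ suc d) (join-splitAt k k i) (go (splitAt k i))
    where
    open ≡-Reasoning
    go : ∀ s → # (⊕ A B π (join k k s)) ≡ suc d
    go (inj₁ a) = begin
      # (⊕ A B π (a ↑ˡ k))                  ≡⟨ sum-++ k _ ⟩
      _ ≡⟨ cong₂ _+_ (#-cong (⊕-ll a)) (#-cong (⊕-lr a)) ⟩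
      # (A a) + # (λ b → does ((π ⟨$⟩ʳ a) ≟ b)) ≡⟨ cong₂ _+_ (A-reg a) (#-pick (π ⟨$⟩ʳ a) (λ _ → true)) ⟩
      d + 1                                 ≡⟨ +-comm d 1 ⟩
      suc d ∎
    go (inj₂ b) = begin
      # (⊕ A B π (k ↑ʳ b))                  ≡⟨ sum-++ k _ ⟩
      _ ≡⟨ cong₂ _+_ (#-cong (⊕-rl b)) (#-cong (⊕-rr b)) ⟩
      # (λ a → does ((π ⟨$⟩ʳ a) ≟ b)) + # (B b)
        ≡⟨ cong₂ _+_ (#-permute (λ c → does (c ≟ b)) π) (B-reg b) ⟩
      # (λ c → does (c ≟ b)) + d
        ≡⟨ cong (_+ d) (trans (#-cong (λ c → ≟-comm c b)) (#-pick b (λ _ → true))) ⟩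
      suc d ∎

  crossing : VSet (k + k) → ℕ
  crossing X = # (λ a → X (a ↑ˡ k) ∧ X (k ↑ʳ (π ⟨$⟩ʳ a)))

  -- `crossing` counts a matching edge once, at its left end. It enters twice here because ordered
  -- pairs see that edge from either end.
  ⊕-induced : ∀ (X : VSet (k + k)) →
    ‖ induced (⊕ A B π) X ‖ ≡
    ‖ induced A (X ∘ (_↑ˡ k)) ‖ + ‖ induced B (X ∘ (k ↑ʳ_)) ‖ + (crossing X + crossing X)
  ⊕-induced X = begin
    ‖ induced (⊕ A B π) X ‖
      ≡⟨ sum-++ k _ ⟩
    sum (λ a → # (induced (⊕ A B π) X (a ↑ˡ k))) + sum (λ b → # (induced (⊕ A B π) X (k ↑ʳ b)))
      ≡⟨ cong₂ _+_ (sum-cong-≗ left) (sum-cong-≗ right) ⟩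
    sum (λ a → # (induced A L a) + # (λ b → lr a b)) + sum (λ b → # (λ a → rl b a) + # (induced B R b))
      ≡⟨ cong₂ _+_ (∑-distrib-+ (λ a → # (induced A L a)) (λ a → # (λ b → lr a b)))
                   (∑-distrib-+ (λ b → # (λ a → rl b a)) (λ b → # (induced B R b))) ⟩
    (‖ induced A L ‖ + sum (λ a → # (λ b → lr a b))) + (sum (λ b → # (λ a → rl b a)) + ‖ induced B R ‖)
      ≡⟨ cong₂ (λ x y → (‖ induced A L ‖ + x) + (y + ‖ induced B R ‖)) lr≡ rl≡ ⟩
    (‖ induced A L ‖ + crossing X) + (crossing X + ‖ induced B R ‖)
      ≡⟨ rearrange (‖ induced A L ‖) (‖ induced B R ‖) (crossing X) ⟩
    ‖ induced A L ‖ + ‖ induced B R ‖ + (crossing X + crossing X) ∎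
    where
    open ≡-Reasoning
    L R : VSet k
    L = X ∘ (_↑ˡ k)
    R = X ∘ (k ↑ʳ_)
    lr rl : Adj k
    lr a b = L a ∧ R b ∧ does ((π ⟨$⟩ʳ a) ≟ b)
    rl b a = R b ∧ L a ∧ does ((π ⟨$⟩ʳ a) ≟ b)
    left : ∀ a → # (induced (⊕ A B π) X (a ↑ˡ k)) ≡ # (induced A L a) + # (λ b → lr a b)
    left a = trans (sum-++ k _) (cong₂ _+_
      (#-cong (λ a′ → cong (λ z → L a ∧ L a′ ∧ z) (⊕-ll a a′)))
      (#-cong (λ b → cong (λ z → L a ∧ R b ∧ z) (⊕-lr a b))))
    right : ∀ b → # (induced (⊕ A B π) X (k ↑ʳ b)) ≡ # (λ a → rl b a) + # (induced B R b)
    right b = trans (sum-++ k _) (cong₂ _+_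
      (#-cong (λ a → cong (λ z → R b ∧ L a ∧ z) (⊕-rl b a)))
      (#-cong (λ b′ → cong (λ z → R b ∧ R b′ ∧ z) (⊕-rr b b′))))
    lr≡ : sum (λ a → # (λ b → lr a b)) ≡ crossing X
    lr≡ = sum-cong-≗ (λ a → trans (#-cong (λ b → sym (∧-assoc (L a) (R b) _)))
                                  (#-pick (π ⟨$⟩ʳ a) (λ b → L a ∧ R b)))
    rl≡ : sum (λ b → # (λ a → rl b a)) ≡ crossing X
    rl≡ = trans (∑-comm (λ b a → ⟦ rl b a ⟧)) (trans
      (‖‖-cong (λ a b → swap (R b) (L a) _)) lr≡)
      where
      swap : ∀ x y z → x ∧ y ∧ z ≡ y ∧ x ∧ z
      swap x y z = trans (sym (∧-assoc x y z)) (trans (cong (_∧ z) (∧-comm x y)) (∧-assoc y x z))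
    rearrange : ∀ x y c → (x + c) + (c + y) ≡ x + y + (c + c)
    rearrange = solve-∀

  crossing-≤ˡ : ∀ X → crossing X ≤ # (X ∘ (_↑ˡ k))
  crossing-≤ˡ X = sum-mono (λ a → ∧-≤ˡ (X (a ↑ˡ k)) _)

  crossing-≤ʳ : ∀ X → crossing X ≤ # (X ∘ (k ↑ʳ_))
  crossing-≤ʳ X = ≤-trans (sum-mono (λ a → ∧-≤ʳ (X (a ↑ˡ k)) _))
                          (≤-reflexive (#-permute (X ∘ (k ↑ʳ_)) π))

#-≤ : ∀ {m} (P : VSet m) → # P ≤ m
#-≤ P = ≤-trans (m≤m+n (# P) _) (≤-reflexive (#-not P))

#-pos : ∀ {m} (P : VSet m) i → P i ≡ true → 1 ≤ # P
#-pos P zero    Pi rewrite Pi = s≤s z≤n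
#-pos P (suc i) Pi = ≤-trans (#-pos (P ∘ suc) i Pi) (m≤n+m _ ⟦ P zero ⟧)

induced-≤-full : ∀ {m} (A : Adj m) X → ‖ induced A X ‖ ≤ ‖ induced A (λ _ → true) ‖
induced-≤-full A X = sum-mono (λ i → sum-mono (λ j →
  ≤-trans (∧-≤ʳ (X i) _) (∧-≤ʳ (X j) _)))

-- Regularity and the edge bound for HL-networks.

HL-symmetric : ∀ {n A} → HL n A → Symmetricᵇ A
HL-symmetric base i j = refl
HL-symmetric (step {A = A} {B} a b π) = ⊕-symmetric A B π (HL-symmetric a) (HL-symmetric b)
HL-symmetric (iso a σ) i j = HL-symmetric a (σ ⟨$⟩ʳ i) (σ ⟨$⟩ʳ j)

HL-irreflexive : ∀ {n A} → HL n A → Irreflexiveᵇ A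
HL-irreflexive base i = refl
HL-irreflexive (step {A = A} {B} a b π) = ⊕-irreflexive A B π (HL-irreflexive a) (HL-irreflexive b)
HL-irreflexive (iso a σ) i = HL-irreflexive a (σ ⟨$⟩ʳ i)

HL-regular : ∀ {n A} → HL n A → ∀ i → # (A i) ≡ n
HL-regular base i = refl
HL-regular (step {A = A} {B} a b π) = ⊕-regular A B π (HL-regular a) (HL-regular b)
HL-regular (iso {A = A} a σ) i = trans (#-permute (A (σ ⟨$⟩ʳ i)) σ) (HL-regular a (σ ⟨$⟩ʳ i))

-- Induction on the construction. `ex-join` is applied with the number of crossing edges as `m`: a
-- matching has no more of them than there are chosen vertices on either side.
HL-induced-≤ : ∀ {n A} → HL n A → ∀ X → ‖ induced A X ‖ ≤ ex n (# X) + ex n (# X)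
HL-induced-≤ base X with X zero
... | true  = z≤n
... | false = z≤n
HL-induced-≤ (step {n} {A} {B} a b π) X = begin
  ‖ induced (⊕ A B π) X ‖
    ≡⟨ ⊕-induced A B π X ⟩
  ‖ induced A L ‖ + ‖ induced B R ‖ + (c + c)
    ≤⟨ +-monoˡ-≤ (c + c) (+-mono-≤ (HL-induced-≤ a L) (HL-induced-≤ b R)) ⟩
  (ex n (# L) + ex n (# L)) + (ex n (# R) + ex n (# R)) + (c + c)
    ≡⟨ rearrange (ex n (# L)) (ex n (# R)) c ⟩
  (ex n (# L) + ex n (# R) + c) + (ex n (# L) + ex n (# R) + c)
    ≤⟨ +-mono-≤ join-bound join-bound ⟩
  ex (suc n) (# L + # R) + ex (suc n) (# L + # R)
    ≡⟨ cong (λ x → ex (suc n) x + ex (suc n) x) (sum-++ (size n) (λ i → ⟦ X i ⟧)) ⟨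
  ex (suc n) (# X) + ex (suc n) (# X) ∎
  where
  open ≤-Reasoning
  L R : VSet (size n)
  L = X ∘ (_↑ˡ size n)
  R = X ∘ (size n ↑ʳ_)
  c = crossing A B π X
  join-bound = ex-join n (# L) (# R) c (#-≤ L) (#-≤ R) (crossing-≤ˡ A B π X) (crossing-≤ʳ A B π X)
  rearrange : ∀ p q c → (p + p) + (q + q) + (c + c) ≡ (p + q + c) + (p + q + c)
  rearrange = solve-∀
HL-induced-≤ (iso {n} {A} a σ) X = begin
  ‖ induced (relabel σ A) X ‖
    ≡⟨ ‖‖-cong (λ i j → cong₂ (λ x y → x ∧ y ∧ relabel σ A i j) (back i) (back j)) ⟩
  ‖ relabel σ (induced A Y) ‖   ≡⟨ relabel-‖‖ (induced A Y) σ ⟩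
  ‖ induced A Y ‖               ≤⟨ HL-induced-≤ a Y ⟩
  ex n (# Y) + ex n (# Y)       ≡⟨ cong (λ x → ex n x + ex n x) (#-permute X (flip σ)) ⟩
  ex n (# X) + ex n (# X)       ∎
  where
  open ≤-Reasoning
  -- The image of `X` under `σ`, so that the relabelled graph on `X` becomes the original graph on
  -- `Y`.
  Y : VSet (size n)
  Y i = X (σ ⟨$⟩ˡ i)
  back : ∀ i → X i ≡ Y (σ ⟨$⟩ʳ i)
  back i = cong X (sym (inverseˡ σ))

-- Sets that attain the edge bound.

glue : ∀ {k l} → VSet k → VSet l → VSet (k + l)
glue {k} L R i = [ L , R ]′ (splitAt k i)

glue-↑ˡ : ∀ {k l} (L : VSet k) (R : VSet l) a → glue L R (a ↑ˡ l) ≡ L a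
glue-↑ˡ {k} {l} L R a = cong [ L , R ]′ (splitAt-↑ˡ k a l)

glue-↑ʳ : ∀ {k l} (L : VSet k) (R : VSet l) b → glue L R (k ↑ʳ b) ≡ R b
glue-↑ʳ {k} {l} L R b = cong [ L , R ]′ (splitAt-↑ʳ k l b)

#-glue : ∀ {k l} (L : VSet k) (R : VSet l) → # (glue L R) ≡ # L + # R
#-glue {k} L R = trans (sum-++ k (λ i → ⟦ glue L R i ⟧))
                       (cong₂ _+_ (#-cong (glue-↑ˡ L R)) (#-cong (glue-↑ʳ L R)))

induced-cong : ∀ {m} {A : Adj m} {X Y : VSet m} → X ≗ Y → ‖ induced A X ‖ ≡ ‖ induced A Y ‖
induced-cong {A = A} X≗Y = ‖‖-cong (λ i j → cong₂ (λ x y → x ∧ y ∧ A i j) (X≗Y i) (X≗Y j))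

⊕-induced-glue : ∀ {k} (A B : Adj k) (π : Permutation′ k) (L R : VSet k) →
  let c = # (λ a → L a ∧ R (π ⟨$⟩ʳ a)) in
  ‖ induced (⊕ A B π) (glue L R) ‖ ≡ ‖ induced A L ‖ + ‖ induced B R ‖ + (c + c)
⊕-induced-glue A B π L R = trans (⊕-induced A B π (glue L R))
  (cong₂ _+_ (cong₂ _+_ (induced-cong (glue-↑ˡ L R)) (induced-cong (glue-↑ʳ L R)))
             (cong (λ c → c + c) (#-cong (λ a → cong₂ _∧_ (glue-↑ˡ L R a) (glue-↑ʳ L R _)))))

#-none : ∀ m → # {m} (λ _ → false) ≡ 0
#-none = sum-replicate-zero

#-all : ∀ m → # {m} (λ _ → true) ≡ m
#-all m = trans (sum-const m 1) (*-identityʳ m)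

-- Greedy filling works for every matching. A set that fits is placed in the left copy; otherwise
-- that copy is filled completely, so each further vertex on the right has its partner in the set.
HL-induced-attained : ∀ {n A} → HL n A → ∀ g → g ≤ size n →
  Σ (VSet (size n)) λ X → # X ≡ g × ex n g + ex n g ≤ ‖ induced A X ‖
HL-induced-attained base zero _ = (λ _ → false) , refl , z≤n
HL-induced-attained base (suc zero) _ = (λ _ → true) , refl , z≤n
HL-induced-attained base (suc (suc g)) (s≤s ())
HL-induced-attained (iso a σ) g g≤ with HL-induced-attained a g g≤
... | X , #X , X-dense =
  (λ i → X (σ ⟨$⟩ʳ i)) , trans (#-permute X σ) #X ,
  ≤-trans X-dense (≤-reflexive (sym (relabel-‖‖ (induced _ X) σ)))
HL-induced-attained (step {n} {A} {B} a b π) g g≤ with ≤-total g (size n)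
... | inj₁ g≤s =
  glue L none , trans (#-glue L none) (trans (cong₂ _+_ #L (#-none (size n))) (+-identityʳ g)) , (begin
    ex (suc n) g + ex (suc n) g     ≤⟨ +-mono-≤ (ex-level n g g≤s) (ex-level n g g≤s) ⟩
    ex n g + ex n g                 ≤⟨ L-dense ⟩
    ‖ induced A L ‖                 ≤⟨ m≤m+n _ _ ⟩
    ‖ induced A L ‖ + ‖ induced B none ‖                   ≤⟨ m≤m+n _ _ ⟩
    ‖ induced A L ‖ + ‖ induced B none ‖ + _               ≡⟨ ⊕-induced-glue A B π L none ⟨
    ‖ induced (⊕ A B π) (glue L none) ‖ ∎)
  where
  open ≤-Reasoning
  ih = HL-induced-attained a g g≤s
  L = proj₁ ih
  #L = proj₁ (proj₂ ih)
  L-dense = proj₂ (proj₂ ih)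
  none : VSet (size n)
  none _ = false
... | inj₂ s≤g =
  glue full R , trans (#-glue full R) (trans (cong₂ _+_ (#-all s) #R) s+r≡g) , (begin
    ex (suc n) g + ex (suc n) g               ≡⟨ cong (λ x → ex (suc n) x + ex (suc n) x) s+r≡g ⟨
    ex (suc n) (s + r) + ex (suc n) (s + r)   ≤⟨ +-mono-≤ (ex-top n r r≤s) (ex-top n r r≤s) ⟩
    (ex n s + ex n r + r) + (ex n s + ex n r + r)
      ≡⟨ rearrange (ex n s) (ex n r) r ⟩
    (ex n s + ex n s) + (ex n r + ex n r) + (r + r)
      -- The extremal `L` of full size only serves to bound the edges of the whole left copy from
      -- below.
      ≤⟨ +-monoˡ-≤ (r + r) (+-mono-≤ (≤-trans L-dense (induced-≤-full A L)) R-dense) ⟩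
    ‖ induced A full ‖ + ‖ induced B R ‖ + (r + r)
      -- With the left copy full, all `r` vertices of `R` are ends of crossing edges.
      ≡⟨ cong (λ x → ‖ induced A full ‖ + ‖ induced B R ‖ + (x + x)) (trans (#-permute R π) #R) ⟨
    _ ≡⟨ ⊕-induced-glue A B π full R ⟨
    ‖ induced (⊕ A B π) (glue full R) ‖ ∎)
  where
  open ≤-Reasoning
  s = size n
  r = g ∸ s
  s+r≡g : s + r ≡ g
  s+r≡g = m+[n∸m]≡n s≤g
  r≤s : r ≤ s
  r≤s = +-cancelˡ-≤ s r s (≤-trans (≤-reflexive s+r≡g) g≤)
  ihˡ = HL-induced-attained a s ≤-refl
  L = proj₁ ihˡ
  L-dense = proj₂ (proj₂ ihˡ)
  ihʳ = HL-induced-attained b r r≤s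
  R = proj₁ ihʳ
  #R = proj₁ (proj₂ ihʳ)
  R-dense = proj₂ (proj₂ ihʳ)
  full : VSet s
  full _ = true
  rearrange : ∀ p q r → (p + q + r) + (p + q + r) ≡ (p + p) + (q + q) + (r + r)
  rearrange = solve-∀

-- Edges incident to a set, and degree counting.

incident : ∀ {m} → Adj m → VSet m → Adj m
incident A X i j = A i j ∧ (X i ∨ X j)

‖incident‖+‖rest‖ : ∀ {m} (A : Adj m) X → ‖ incident A X ‖ + ‖ induced A (not ∘ X) ‖ ≡ ‖ A ‖
‖incident‖+‖rest‖ A X = trans
  (sym (sum₂-distrib-+ (λ i j → ⟦ incident A X i j ⟧) (λ i j → ⟦ induced A (not ∘ X) i j ⟧)))
  (sum-cong-≗ (λ i → sum-cong-≗ (λ j → pointwise (X i) (X j) (A i j))))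
  where
  pointwise : ∀ x y a → ⟦ a ∧ (x ∨ y) ⟧ + ⟦ not x ∧ not y ∧ a ⟧ ≡ ⟦ a ⟧
  pointwise false false false = refl
  pointwise false false true  = refl
  pointwise false true  false = refl
  pointwise false true  true  = refl
  pointwise true  y     false = refl
  pointwise true  y     true  = refl

module _ {m d : ℕ} (A : Adj m) (A-sym : Symmetricᵇ A) (A-reg : ∀ i → # (A i) ≡ d) where

  degree-sum : ∀ X → ‖ (λ i j → X i ∧ A i j) ‖ ≡ d * # X
  degree-sum X = trans (sum-cong-≗ row) (sym (*-distribˡ-sum d (λ i → ⟦ X i ⟧)))
    where
    row : ∀ i → # (λ j → X i ∧ A i j) ≡ d * ⟦ X i ⟧
    row i with X i
    ... | true  = trans (A-reg i) (sym (*-identityʳ d))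
    ... | false = trans (#-none m) (sym (*-zeroʳ d))

  -- Inclusion and exclusion over the two ends of each edge; exchanging the summations turns the
  -- second degree sum into the first.
  ‖incident‖+‖induced‖ : ∀ X → ‖ incident A X ‖ + ‖ induced A X ‖ ≡ d * # X + d * # X
  ‖incident‖+‖induced‖ X = begin
    ‖ incident A X ‖ + ‖ induced A X ‖
      ≡⟨ sum₂-distrib-+ (λ i j → ⟦ incident A X i j ⟧) (λ i j → ⟦ induced A X i j ⟧) ⟨
    sum (λ i → sum (λ j → ⟦ incident A X i j ⟧ + ⟦ induced A X i j ⟧))
      ≡⟨ sum-cong-≗ (λ i → sum-cong-≗ (λ j →
           trans (pointwise (X i) (X j) (A i j)) (cong (λ a → ⟦ X i ∧ A i j ⟧ + ⟦ X j ∧ a ⟧) (A-sym i j)))) ⟩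
    sum (λ i → sum (λ j → ⟦ X i ∧ A i j ⟧ + ⟦ X j ∧ A j i ⟧))
      ≡⟨ sum₂-distrib-+ (λ i j → ⟦ X i ∧ A i j ⟧) (λ i j → ⟦ X j ∧ A j i ⟧) ⟩
    ‖ (λ i j → X i ∧ A i j) ‖ + sum (λ i → sum (λ j → ⟦ X j ∧ A j i ⟧))
      ≡⟨ cong₂ _+_ (degree-sum X) (trans (∑-comm (λ i j → ⟦ X j ∧ A j i ⟧)) (degree-sum X)) ⟩
    d * # X + d * # X ∎
    where
    open ≡-Reasoning
    pointwise : ∀ x y a → ⟦ a ∧ (x ∨ y) ⟧ + ⟦ x ∧ y ∧ a ⟧ ≡ ⟦ x ∧ a ⟧ + ⟦ y ∧ a ⟧
    pointwise false false false = refl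
    pointwise false false true  = refl
    pointwise false true  false = refl
    pointwise false true  true  = refl
    pointwise true  false false = refl
    pointwise true  false true  = refl
    pointwise true  true  false = refl
    pointwise true  true  true  = refl

incident-symmetric : ∀ {m} {A : Adj m} (X : VSet m) → Symmetricᵇ A → Symmetricᵇ (incident A X)
incident-symmetric X A-sym i j = cong₂ _∧_ (A-sym i j) (∨-comm (X i) (X j))

incident-⊆ : ∀ {m} {A : Adj m} (X : VSet m) i j → incident A X i j ≡ true → A i j ≡ true
incident-⊆ {A = A} X i j e with A i j
... | true  = refl
... | false = e

⊆-irreflexive : ∀ {m} {A F : Adj m} → (∀ i j → F i j ≡ true → A i j ≡ true) →
                Irreflexiveᵇ A → Irreflexiveᵇ F
⊆-irreflexive {F = F} F⊆A A-irrefl i with F i i in eq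
... | false = refl
... | true  = trans (sym (F⊆A i i eq)) (A-irrefl i)

-- Components left after deleting the incident edges.

-- The enumeration supplies distinct component representatives, and also extracts an element from a
-- set of positive count.
members : ∀ {m} (P : VSet m) →
  Σ (Fin (# P) → Fin m) λ r → (∀ a → P (r a) ≡ true) × (∀ a b → r a ≡ r b → a ≡ b)
members {zero}  P = (λ ()) , (λ ()) , (λ ())
members {suc m} P with P zero in eq | members (P ∘ suc)
... | false | r , r-in , r-inj = suc ∘ r , r-in , λ a b e → r-inj a b (suc-injective e)
... | true  | r , r-in , r-inj = r′ , r′-in , r′-inj
  where
  r′ : Fin (suc (# (P ∘ suc))) → Fin (suc m)
  r′ zero    = zero
  r′ (suc a) = suc (r a)
  r′-in : ∀ a → P (r′ a) ≡ true
  r′-in zero    = eq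
  r′-in (suc a) = r-in a
  r′-inj : ∀ a b → r′ a ≡ r′ b → a ≡ b
  r′-inj zero    zero    e = refl
  r′-inj (suc a) (suc b) e = cong suc (r-inj a b (suc-injective e))

module _ {m : ℕ} (A : Adj m) (X : VSet m) where

  private
    D : Adj m
    D = deleteEdges A (incident A X)

  incident-deletedˡ : ∀ {i j} → X i ≡ true → D i j ≢ true
  incident-deletedˡ {i} {j} Xi e rewrite Xi with A i j
  incident-deletedˡ Xi () | true
  incident-deletedˡ Xi () | false

  incident-deletedʳ : ∀ {i j} → X j ≡ true → D i j ≢ true
  incident-deletedʳ {i} {j} Xj e rewrite Xj | ∨-zeroʳ (X i) with A i j
  incident-deletedʳ Xj () | true
  incident-deletedʳ Xj () | false

  isolatedˡ : ∀ {i j} → X i ≡ true → Reach D i j → i ≡ j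
  isolatedˡ Xi here        = refl
  isolatedˡ Xi (there e _) = contradiction e (incident-deletedˡ Xi)

  isolatedʳ : ∀ {i j} → X j ≡ true → Reach D i j → i ≡ j
  isolatedʳ Xj here        = refl
  isolatedʳ Xj (there e p) with isolatedʳ Xj p
  ... | refl = contradiction e (incident-deletedʳ Xj)

  -- Deletion isolates every vertex of `X`. The vertex `w` outside `X` represents the additional
  -- component.
  incident-components : ∀ w → X w ≡ false → AtLeastComponents (# X + 1) D
  incident-components w Xw = reps ∘ splitAt (# X) , λ a b a≢b p → a≢b (begin
    a                                ≡⟨ join-splitAt (# X) 1 a ⟨
    join (# X) 1 (splitAt (# X) a)   ≡⟨ cong (join (# X) 1) (separated (splitAt (# X) a) (splitAt (# X) b) p) ⟩
    join (# X) 1 (splitAt (# X) b)   ≡⟨ join-splitAt (# X) 1 b ⟩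
    b                                ∎)
    where
    open ≡-Reasoning
    r = proj₁ (members X)
    r-in = proj₁ (proj₂ (members X))
    r-inj = proj₂ (proj₂ (members X))
    reps : Fin (# X) ⊎ Fin 1 → Fin m
    reps = [ r , (λ _ → w) ]′
    w∉X : ∀ {a} → r a ≢ w
    w∉X {a} e with trans (sym (r-in a)) (trans (cong X e) Xw)
    ... | ()
    separated : ∀ s t → Reach D (reps s) (reps t) → s ≡ t
    separated (inj₁ a) (inj₁ b) p = cong inj₁ (r-inj a b (isolatedˡ (r-in a) p))
    separated (inj₁ a) (inj₂ _) p = contradiction (isolatedˡ (r-in a) p) w∉X
    separated (inj₂ _) (inj₁ b) p = contradiction (sym (isolatedʳ (r-in b) p)) w∉X
    separated (inj₂ zero) (inj₂ zero) p = refl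

-- From separated representatives to a partition of the vertices.

reach-trans : ∀ {m} {D : Adj m} {i j k} → Reach D i j → Reach D j k → Reach D i k
reach-trans here        q = q
reach-trans (there e p) q = there e (reach-trans p q)

reach-sym : ∀ {m} {D : Adj m} → Symmetricᵇ D → ∀ {i j} → Reach D i j → Reach D j i
reach-sym D-sym here        = here
reach-sym D-sym (there e p) = reach-trans (reach-sym D-sym p) (there (trans (D-sym _ _) e) here)

-- A grouping of the components into `k` nonempty classes: a class may unite several components, but
-- no surviving edge runs between classes.
record Labelling {m} (k : ℕ) (D : Adj m) : Set where
  field
    label    : Fin m → Fin k
    onto     : ∀ a → Σ (Fin m) λ v → label v ≡ a
    constant : ∀ i j → D i j ≡ true → label i ≡ label j

-- A vertex takes the label of the representative that reaches it, and `default` if none does. By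
-- symmetry, being reached from a given representative passes along edges in both directions, so
-- labels are constant on edges.
labelling : ∀ {m k} {D : Adj m} → Symmetricᵇ D → Fin k → (comps : AtLeastComponents k D) →
            (∀ a v → Dec (Reach D (proj₁ comps a) v)) → Labelling k D
labelling {m} {k} {D} D-sym default (r , r-sep) reach? = record
  { label = label ; onto = λ a → r a , label-unique here ; constant = constant }
  where
  unique : ∀ {a b v} → Reach D (r a) v → Reach D (r b) v → a ≡ b
  unique {a} {b} p q with a ≟ b
  ... | yes a≡b = a≡b
  ... | no  a≢b = contradiction (reach-trans p (reach-sym D-sym q)) (r-sep a b a≢b)
  label : Fin m → Fin k
  label v with any? (λ a → reach? a v)
  ... | yes (a , _) = a
  ... | no _        = default
  label-unique : ∀ {a v} → Reach D (r a) v → label v ≡ a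
  label-unique {a} {v} p with any? (λ a → reach? a v)
  ... | yes (b , q) = unique q p
  ... | no ¬q       = contradiction (a , p) ¬q
  constant : ∀ i j → D i j ≡ true → label i ≡ label j
  constant i j e with any? (λ a → reach? a i)
  ... | yes (a , p) = sym (label-unique (reach-trans p (there e here)))
  ... | no ¬p with any? (λ a → reach? a j)
  ...   | yes (b , q) = contradiction (b , reach-trans q (there (trans (D-sym j i) e) here)) ¬p
  ...   | no _        = refl

-- Reachability is not decided here; the double negation is harmless because the
-- inequality it serves is decidable.
¬¬-labelling : ∀ {m k} {D : Adj m} → Symmetricᵇ D → Fin k → AtLeastComponents k D →
               ¬ ¬ Labelling k D
¬¬-labelling D-sym default comps =
  ¬¬-map (labelling D-sym default comps) (pull (λ a → pull (λ v → ¬¬-excluded-middle)))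
  where
  pull : ∀ {n} {P : Fin n → Set} → (∀ i → ¬ ¬ P i) → ¬ ¬ (∀ i → P i)
  pull = sequence (RawMonad.rawApplicative ¬¬-Monad)

-- Edge counts over the parts.

module _ {m k : ℕ} (A F : Adj m) (ℓ : Labelling k (deleteEdges A F)) where
  open Labelling ℓ

  part : Fin k → VSet m
  part a v = does (label v ≟ a)

  part-nonempty : ∀ a → 1 ≤ # (part a)
  part-nonempty a with onto a
  ... | v , v∈a = #-pos (part a) v (dec-true (label v ≟ a) v∈a)

  sum-#-part : sum (λ a → # (part a)) ≡ m
  sum-#-part = begin
    sum (λ a → # (part a))                       ≡⟨ ∑-comm (λ a v → ⟦ part a v ⟧) ⟩
    sum (λ v → # (λ a → does (label v ≟ a)))     ≡⟨ sum-cong-≗ (λ v → #-pick (label v) (λ _ → true)) ⟩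
    sum {m} (λ _ → 1)                            ≡⟨ #-all m ⟩
    m                                            ∎
    where open ≡-Reasoning

  -- An edge outside `F` survives the deletion, so its ends share a label and it is counted inside
  -- that part.
  edges-≤-cut+parts : ‖ A ‖ ≤ ‖ F ‖ + sum (λ a → ‖ induced A (part a) ‖)
  edges-≤-cut+parts = begin
    ‖ A ‖
      ≤⟨ sum-mono (λ i → sum-mono (λ j → pointwise i j)) ⟩
    sum (λ i → sum (λ j → ⟦ F i j ⟧ + # (λ a → induced A (part a) i j)))
      ≡⟨ sum₂-distrib-+ (λ i j → ⟦ F i j ⟧) (λ i j → # (λ a → induced A (part a) i j)) ⟩
    ‖ F ‖ + sum (λ i → sum (λ j → # (λ a → induced A (part a) i j)))
      ≡⟨ cong (‖ F ‖ +_) (sum-cong-≗ (λ i → ∑-comm (λ j a → ⟦ induced A (part a) i j ⟧))) ⟩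
    ‖ F ‖ + sum (λ i → sum (λ a → # (λ j → induced A (part a) i j)))
      ≡⟨ cong (‖ F ‖ +_) (∑-comm (λ i a → # (λ j → induced A (part a) i j))) ⟩
    ‖ F ‖ + sum (λ a → ‖ induced A (part a) ‖) ∎
    where
    open ≤-Reasoning
    -- Only the part labelled `label i` contains `i`, so the sum over parts has at most one nonzero
    -- term.
    same-part : ∀ i j → # (λ a → induced A (part a) i j) ≡ ⟦ does (label j ≟ label i) ∧ A i j ⟧
    same-part i j = trans (#-cong (λ a → ∧-comm (part a i) (part a j ∧ A i j)))
                          (#-pick (label i) (λ a → part a j ∧ A i j))
    pointwise : ∀ i j → ⟦ A i j ⟧ ≤ ⟦ F i j ⟧ + # (λ a → induced A (part a) i j)
    pointwise i j rewrite same-part i j with constant i j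
    ... | same with A i j | F i j
    ... | false | _     = z≤n
    ... | true  | true  = s≤s z≤n
    ... | true  | false rewrite dec-true (label j ≟ label i) (sym (same refl)) = ≤-refl

-- Parts are merged one at a time by `ex-shift`, each merge leaving a singleton behind. After `k`
-- merges a part of size `t` remains beside `k` singletons, which span no edges.
ex-parts : ∀ n k (s : Fin (k + 1) → ℕ) → (∀ a → 1 ≤ s a) → sum s ≤ size n →
  Σ ℕ λ t → sum s ≡ t + k × 1 ≤ t × sum (λ a → ex n (s a)) ≤ ex n t
ex-parts n zero s s-pos _ = s zero , refl , s-pos zero , ≤-reflexive (+-identityʳ _)
ex-parts n (suc k) s s-pos s≤
  with ex-parts n k (s ∘ suc) (s-pos ∘ suc) (≤-trans (m≤n+m _ (s zero)) s≤) | s zero | s-pos zero | s≤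
-- Both sizes are positive, so they have the successor form that `ex-shift` takes; the merged part
-- has `suc (u + t)` vertices.
... | suc t , sum≡ , _ , bound | suc u | _ | total≤ = suc (u + t) , total , s≤s z≤n , (begin
  ex n (suc u) + sum (λ a → ex n (s (suc a)))  ≤⟨ +-monoʳ-≤ (ex n (suc u)) bound ⟩
  ex n (suc u) + ex n (suc t)
    ≤⟨ ex-shift n u t (≤-trans (m≤m+n _ (suc k)) (≤-trans (≤-reflexive (sym total)) total≤)) ⟩
  ex n (suc (u + t))                           ∎)
  where
  open ≤-Reasoning
  arg : ∀ u t k → suc u + (suc t + k) ≡ suc (u + t) + suc k
  arg = solve-∀
  total : suc u + sum (s ∘ suc) ≡ suc (u + t) + suc k
  total = trans (cong (suc u +_) sum≡) (arg u t k)

-- Room for a vertex outside the extremal set.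

size≡2^ : ∀ n → size n ≡ 2 ^ n
size≡2^ zero = refl
size≡2^ (suc n) rewrite size≡2^ n = cong (2 ^ n +_) (sym (+-identityʳ (2 ^ n)))

-- `⌈ n /2⌉` is strictly below `n` from two onwards. Strictness leaves a vertex outside a `g`-set,
-- which the last component requires.
2^⌈/2⌉<size : ∀ n {g} → 8 ≤ n → g ≤ 2 ^ ⌈ n /2⌉ → g < size n
2^⌈/2⌉<size (suc zero) (s≤s ())
2^⌈/2⌉<size n@(suc (suc k)) _ g≤ = ≤-<-trans g≤
  (subst (2 ^ ⌈ n /2⌉ <_) (sym (size≡2^ n)) (^-monoʳ-< 2 ≤-refl (⌈n/2⌉<n k)))

missing : ∀ {m} (X : VSet m) → # X < m → Σ (Fin m) λ w → X w ≡ false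
missing {m} X #X< with # (not ∘ X) in eq | members (not ∘ X)
... | zero  | _ = contradiction (subst (# X <_) (sym (trans (sym (+-identityʳ (# X)))
                    (trans (cong (# X +_) (sym eq)) (#-not X)))) #X<) (<-irrefl refl)
... | suc _ | r , r-in , _ = r zero , trans (sym (not-involutive _)) (cong not (r-in zero))

-- Upper and lower bounds for cuts of an HL-network.

module _ {n : ℕ} {G : Adj (size n)} (hl : HL n G) where

  private
    G-sym = HL-symmetric hl
    G-irrefl = HL-irreflexive hl
    G-reg = HL-regular hl

  double-inducedEdges : ∀ X → inducedEdges G X + inducedEdges G X ≡ ‖ induced G X ‖
  double-inducedEdges X =
    double-countPairs (induced G X) (induced-symmetric X G-sym) (induced-irreflexive {A = G} X G-irrefl)

  incident-isKCut : ∀ X → # X < size n → IsKCut (# X + 1) G (incident G X)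
  incident-isKCut X #X< with missing X #X<
  ... | w , Xw = (incident-symmetric X G-sym , incident-⊆ X) , incident-components G X w Xw

  -- The doubled identity over ordered pairs is halved to `c + i ≡ n * # X`, which makes the
  -- truncated subtraction exact.
  countPairs-incident : ∀ X → countPairs (incident G X) ≡ n * # X ∸ inducedEdges G X
  countPairs-incident X = begin
    c               ≡⟨ m+n∸n≡m c i ⟨
    (c + i) ∸ i     ≡⟨ cong (_∸ i) (≤-antisym (double-cancel-≤ (≤-reflexive doubled))
                                              (double-cancel-≤ (≤-reflexive (sym doubled)))) ⟩
    n * # X ∸ i     ∎
    where
    open ≡-Reasoning
    c = countPairs (incident G X)
    i = inducedEdges G X
    shuffle : ∀ c i → (c + i) + (c + i) ≡ (c + c) + (i + i)
    shuffle = solve-∀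
    doubled : (c + i) + (c + i) ≡ n * # X + n * # X
    doubled = begin
      (c + i) + (c + i)                    ≡⟨ shuffle c i ⟩
      (c + c) + (i + i)
        ≡⟨ cong₂ _+_ (double-countPairs (incident G X) (incident-symmetric X G-sym)
                       (⊆-irreflexive {A = G} (incident-⊆ {A = G} X) G-irrefl)) (double-inducedEdges X) ⟩
      ‖ incident G X ‖ + ‖ induced G X ‖   ≡⟨ ‖incident‖+‖induced‖ G G-sym G-reg X ⟩
      n * # X + n * # X                    ∎

  -- The incident edges complete the complement's edges to the whole graph and complete the edges
  -- inside `X` to the degree sum; eliminating them relates the two induced counts.
  complement-balance : ∀ X →
    ‖ induced G (not ∘ X) ‖ + (n * # X + n * # X) ≡ ‖ G ‖ + ‖ induced G X ‖
  complement-balance X = begin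
    r + (n * # X + n * # X)   ≡⟨ cong (r +_) (‖incident‖+‖induced‖ G G-sym G-reg X) ⟨
    r + (c + i)               ≡⟨ shuffle r c i ⟩
    (c + r) + i               ≡⟨ cong (_+ i) (‖incident‖+‖rest‖ G X) ⟩
    ‖ G ‖ + i                 ∎
    where
    open ≡-Reasoning
    r = ‖ induced G (not ∘ X) ‖
    c = ‖ incident G X ‖
    i = ‖ induced G X ‖
    shuffle : ∀ r c i → r + (c + i) ≡ (c + r) + i
    shuffle = solve-∀

  -- The bound at size n ∸ g is transferred to size g by complementing an extremal set.
  ex-complement : ∀ t g → t + g ≡ size n →
    (ex n t + ex n t) + (n * g + n * g) ≤ ‖ G ‖ + (ex n g + ex n g)
  ex-complement t g t+g≡ with HL-induced-attained hl t (≤-trans (m≤m+n t g) (≤-reflexive t+g≡))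
  ... | Y , #Y , Y-dense = begin
    (ex n t + ex n t) + (n * g + n * g)         ≤⟨ +-monoˡ-≤ _ Y-dense ⟩
    ‖ induced G Y ‖ + (n * g + n * g)
      ≡⟨ cong₂ (λ x y → x + (n * y + n * y)) (induced-cong (λ i → sym (not-involutive (Y i)))) (sym #X) ⟩
    ‖ induced G (not ∘ X) ‖ + (n * # X + n * # X) ≡⟨ complement-balance X ⟩
    ‖ G ‖ + ‖ induced G X ‖                     ≤⟨ +-monoʳ-≤ ‖ G ‖ (HL-induced-≤ hl X) ⟩
    ‖ G ‖ + (ex n (# X) + ex n (# X))           ≡⟨ cong (λ x → ‖ G ‖ + (ex n x + ex n x)) #X ⟩
    ‖ G ‖ + (ex n g + ex n g)                   ∎
    where
    open ≤-Reasoning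
    X : VSet (size n)
    X = not ∘ Y
    #X : # X ≡ g
    #X = +-cancelˡ-≡ t (# X) g (trans (cong (_+ # X) (sym #Y)) (trans (#-not Y) (sym t+g≡)))

  -- The additive form avoids truncated subtraction. Being a decidable inequality, it may be derived
  -- from a labelling known only up to double negation.
  kCut-≥ : ∀ g F → IsKCut (g + 1) G F → n * g ≤ ex n g + countPairs F
  kCut-≥ g F ((F-sym , F⊆G) , comps) =
    -- `g ↑ʳ zero` is the last of the `g + 1` labels, taken as the default.
    decidable-stable (_ ≤? _) (¬¬-map bound (¬¬-labelling D-sym (g ↑ʳ zero) comps))
    where
    D-sym : Symmetricᵇ (deleteEdges G F)
    D-sym i j = cong₂ (λ x y → x ∧ not y) (G-sym i j) (F-sym i j)
    c = countPairs F
    e = ex n g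
    bound : Labelling (g + 1) (deleteEdges G F) → n * g ≤ e + c
    bound ℓ with ex-parts n g (λ a → # (part G F ℓ a)) (part-nonempty G F ℓ)
                              (≤-reflexive (sum-#-part G F ℓ))
    -- Here `t + g` is the number of vertices. `ex n t` bounds the edges inside the parts and is
    -- itself bounded by `ex-complement`; adding the two bounds lets `‖ G ‖` and `h` cancel.
    ... | t , sum≡ , _ , parts≤ = double-cancel-≤ (+-cancelˡ-≤ (‖ G ‖ + (ex n t + ex n t)) _ _ (begin
      (‖ G ‖ + (h + h)) + (n * g + n * g)    ≡⟨ +-assoc ‖ G ‖ (h + h) _ ⟩
      ‖ G ‖ + ((h + h) + (n * g + n * g))
        ≤⟨ +-mono-≤ G≤ (ex-complement t g (trans (sym sum≡) (sum-#-part G F ℓ))) ⟩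
      ((c + c) + (h + h)) + (‖ G ‖ + (e + e)) ≡⟨ shuffle c h ‖ G ‖ e ⟩
      (‖ G ‖ + (h + h)) + ((e + c) + (e + c)) ∎))
      where
      open ≤-Reasoning
      h = ex n t
      shuffle : ∀ c h G e → ((c + c) + (h + h)) + (G + (e + e)) ≡ (G + (h + h)) + ((e + c) + (e + c))
      shuffle = solve-∀
      G≤ : ‖ G ‖ ≤ (c + c) + (h + h)
      G≤ = begin
        ‖ G ‖
          ≤⟨ edges-≤-cut+parts G F ℓ ⟩
        ‖ F ‖ + sum (λ a → ‖ induced G (part G F ℓ a) ‖)
          ≤⟨ +-monoʳ-≤ ‖ F ‖ (sum-mono (λ a → HL-induced-≤ hl (part G F ℓ a))) ⟩
        ‖ F ‖ + sum (λ a → ex n (# (part G F ℓ a)) + ex n (# (part G F ℓ a)))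
          ≡⟨ cong₂ _+_ (sym (double-countPairs F F-sym (⊆-irreflexive {A = G} F⊆G G-irrefl)))
               (∑-distrib-+ (λ a → ex n (# (part G F ℓ a))) (λ a → ex n (# (part G F ℓ a)))) ⟩
        (c + c) + (sum (λ a → ex n (# (part G F ℓ a))) + sum (λ a → ex n (# (part G F ℓ a))))
          ≤⟨ +-monoʳ-≤ (c + c) (+-mono-≤ parts≤ parts≤) ⟩
        (c + c) + (h + h) ∎

-- Both bounds at an extremal set.

theorem3p2 : (n : ℕ) → 8 ≤ n → (G : Adj (size n)) → HL n G →
    (g : ℕ) → 1 ≤ g → g ≤ 2 ^ ⌈ n /2⌉ →
    Σ ℕ λ e → IsMaxInduced G g e × IsCλ (g + 1) G (n * g ∸ e)
theorem3p2 n 8≤n G hl g 1≤g g≤ with HL-induced-attained hl g (<⇒≤ (2^⌈/2⌉<size n 8≤n g≤))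
-- Matching on `refl` replaces `g` by `# X`. The same extremal set attains the maximum and provides
-- the cut.
... | X , refl , X-dense = e ,
  ((X , count≡# X , refl) , λ Y #Y → maximal Y (trans (sym (count≡# Y)) #Y)) ,
  ((incident G X , incident-isKCut hl X (2^⌈/2⌉<size n 8≤n g≤) , countPairs-incident hl X) ,
   -- Since `ex n (# X)` is at most `e`, the lower bound for cuts also holds with `e`, and it then
   -- passes to the truncated difference.
   λ F cut → m≤n+o⇒m∸n≤o (n * # X) e (≤-trans (kCut-≥ hl (# X) F cut) (+-monoˡ-≤ _ ex≤e)))
  where
  e = inducedEdges G X
  ex≤e : ex n (# X) ≤ e
  ex≤e = double-cancel-≤ (≤-trans X-dense (≤-reflexive (sym (double-inducedEdges hl X))))
  maximal : ∀ Y → # Y ≡ # X → inducedEdges G Y ≤ e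
  maximal Y #Y = ≤-trans (double-cancel-≤ (begin
    inducedEdges G Y + inducedEdges G Y   ≡⟨ double-inducedEdges hl Y ⟩
    ‖ induced G Y ‖                       ≤⟨ HL-induced-≤ hl Y ⟩
    ex n (# Y) + ex n (# Y)               ≡⟨ cong (λ x → ex n x + ex n x) #Y ⟩
    ex n (# X) + ex n (# X)               ∎)) ex≤e
    where open ≤-Reasoning
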